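{- Let $G=(V,E)$ be a signed graph with $|V|=4$. Then $G$ is signed-eliminable if and only if at least one of the following conditions is satisfied: (FV1) $G_+$ or $G_-$ has a vertex of degree three. (FV2) Both $G_+$ and $G_-$ are chordal, $G$ is not a mountain, and $G$ has no alternating $4$-path.
   Context: All graphs are finite, simple and undirected. A signed graph is a graph $G=(V,E)$ together with a partition $E=E_+\sqcup E_-$ (either part may be empty); put $G_\sigma=(V,E_\sigma)$ for $\sigma\in\{+,-\}$, and let $-\sigma$ be the opposite sign. A graph is chordal if it has no induced cycle of length at least four. An ordering on $G$ is a bijection $\nu:V\to\{1,\dots,|V|\}$. It is a signed elimination ordering (SEO) if for every triple $(u,v,w)$ of distinct vertices with $\nu(u)<\nu(w)>\nu(v)$ and each $\sigma\in\{+,-\}$: (E1) if $uw,wv\in E_\sigma$ then $uv\in E_\sigma$; (E2) if $uv\in E_\sigma$ and $vw\in E_{ -\sigma}$ then $uw\in E_\sigma$. $G$ is signed-eliminable if it admits a SEO. An alternating $4$-path in $G$ consists of four distinct vertices $u,v,w,x$ and a sign $\sigma\in\{+,-\}$ with $uv\in E_\sigma$, $vw\in E_{ -\sigma}$, $wx\in E_\sigma$ (other pairs among these vertices may or may not be edges). A mountain is a signed graph for which there are $\sigma\in\{+,-\}$ and an enumeration $(v_1,\dots,v_n;w)$ of its (distinct) vertices, $n\ge 3$, such that $v_iv_{i+1}\in E_{ -\sigma}$ for $1\le i\le n-1$, $wv_i\in E_\sigma$ for $2\le i\le n-1$, and no other pair of vertices is joined by an edge. -}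

module Defs where

open import Data.Fin.Base using (Fin; toℕ; _<_)
open import Data.List.Base using (List; []; _∷_; length; filter; map; allFin)
open import Data.List.Relation.Unary.Unique.Propositional using (Unique)
open import Data.Nat.Base as ℕ using (ℕ; suc)
open import Data.Product.Base using (Σ-syntax; ∃; ∃-syntax; _×_; _,_)
open import Data.Sign.Base using (Sign; opposite)
open import Data.Sum.Base using (_⊎_; inj₁; inj₂)
open import Function.Base using (_∘_)
open import Function.Bundles using (_↔_; _⤖_; _⇔_; Inverse; Bijection)
open import Function.Definitions using (Injective)
open import Level using (0ℓ)
open import Relation.Binary.Core using (Rel; _⇒_)
open import Relation.Binary.Definitions using (Decidable; Symmetric; Irreflexive)
open import Relation.Binary.PropositionalEquality using (_≡_; _≢_)
open import Relation.Nullary using (¬_; yes; no)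

-- A finite simple graph on n vertices.  The vertex set is an arbitrary type in
-- bijection with Fin n; adj? says that the edges form a finite (decidable)
-- subset of the set of pairs.
record Graph (n : ℕ) : Set₁ where
  field
    V          : Set
    enumerate  : V ↔ Fin n
    Adj        : Rel V 0ℓ
    adj?       : Decidable Adj
    adj-sym    : Symmetric Adj
    adj-irrefl : Irreflexive _≡_ Adj

  vertices : List V
  vertices = map (Inverse.from enumerate) (allFin n)

  degree : V → ℕ
  degree v = length (filter (adj? v) vertices)

Consecutive : ∀ {k} → Rel (Fin k) 0ℓ
Consecutive i j = suc (toℕ i) ≡ toℕ j ⊎ suc (toℕ j) ≡ toℕ i

Interior : ∀ {m} → Fin m → Set
Interior {m} i = 0 ℕ.< toℕ i × suc (toℕ i) ℕ.< m

-- Adjacency in the cycle 0, 1, …, k-1, 0 (intended for k ≥ 3).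
CyclicallyConsecutive : ∀ {k} → Rel (Fin k) 0ℓ
CyclicallyConsecutive {k} i j =
  Consecutive i j
    ⊎ (toℕ i ≡ 0 × suc (toℕ j) ≡ k)
    ⊎ (toℕ j ≡ 0 × suc (toℕ i) ≡ k)

module _ {n} (G : Graph n) where
  open Graph G

  InducedCycle : ℕ → Set
  InducedCycle k =
    Σ[ c ∈ (Fin k → V) ]
      Injective _≡_ _≡_ c × (∀ i j → Adj (c i) (c j) ⇔ CyclicallyConsecutive i j)

  Chordal : Set
  Chordal = ∀ k → 4 ℕ.≤ k → ¬ InducedCycle k

  HasVertexOfDegree : ℕ → Set
  HasVertexOfDegree d = ∃[ v ] degree v ≡ d

record SignedGraph (n : ℕ) : Set₁ where
  field
    graph : Graph n

  open Graph graph public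

  field
    E        : Sign → Rel V 0ℓ
    E-sym    : ∀ σ → Symmetric (E σ)
    E⇒adj    : ∀ σ → E σ ⇒ Adj
    adj⇒E    : ∀ {u v} → Adj u v → ∃[ σ ] E σ u v
    disjoint : ∀ {u v} → E Sign.+ u v → ¬ E Sign.- u v

  E? : ∀ σ → Decidable (E σ)
  E? σ u v with adj? u v
  ... | no ¬a = no (¬a ∘ E⇒adj σ)
  ... | yes a with σ | adj⇒E a
  ...   | Sign.+ | Sign.+ , e = yes e
  ...   | Sign.+ | Sign.- , e = no λ e₊ → disjoint e₊ e
  ...   | Sign.- | Sign.+ , e = no (disjoint e)
  ...   | Sign.- | Sign.- , e = yes e

  part : Sign → Graph n
  part σ = record
    { V          = V
    ; enumerate  = enumerate
    ; Adj        = E σ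
    ; adj?       = E? σ
    ; adj-sym    = E-sym σ
    ; adj-irrefl = λ u≡v → adj-irrefl u≡v ∘ E⇒adj σ
    }

module _ {n} (G : SignedGraph n) where
  open SignedGraph G

  -- The values 1, …, n of an ordering are shifted to 0, …, n-1.
  Ordering : Set
  Ordering = V ⤖ Fin n

  IsSEO : Ordering → Set
  IsSEO ordering =
    ∀ u v w → Unique (u ∷ v ∷ w ∷ []) → ν u < ν w → ν v < ν w → ∀ σ →
      (E σ u w → E σ w v → E σ u v)
        × (E σ u v → E (opposite σ) v w → E σ u w)
    where ν = Bijection.to ordering

  SignedEliminable : Set
  SignedEliminable = ∃ IsSEO

  AlternatingFourPath : Set
  AlternatingFourPath =
    ∃[ u ] ∃[ v ] ∃[ w ] ∃[ x ] ∃[ σ ]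
      Unique (u ∷ v ∷ w ∷ x ∷ [])
        × E σ u v × E (opposite σ) v w × E σ w x

  -- The indices of v₁, …, vₘ are shifted to 0, …, m-1.
  record IsMountainEnumeration (σ : Sign) {m : ℕ} (v : Fin m → V) (w : V) : Set where
    field
      3≤m         : 3 ℕ.≤ m
      v-injective : Injective _≡_ _≡_ v
      w≢v         : ∀ i → w ≢ v i
      exhaustive  : ∀ x → x ≡ w ⊎ ∃[ i ] x ≡ v i
      path-edge   : ∀ i j → suc (toℕ i) ≡ toℕ j → E (opposite σ) (v i) (v j)
      apex-edge   : ∀ i → Interior i → E σ w (v i)
      path-only   : ∀ i j → Adj (v i) (v j) → Consecutive i j
      apex-only   : ∀ i → Adj w (v i) → Interior i

  Mountain : Set
  Mountain =
    ∃[ σ ] ∃[ m ] Σ[ v ∈ (Fin m → V) ] ∃[ w ] IsMountainEnumeration σ {m} v w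

{-# OPTIONS --safe #-}

-- Necessity: in a set of distinct vertices, (E1) and (E2) hold at the one ordered
-- last.  This rules out an induced 4-cycle and a mountain, and it forces an end of
-- an alternating 4-path to be joined to the three other vertices with one sign.
-- Sufficiency: a signed graph on four vertices is a colouring of six pairs by
-- three colours, and each of the 729 colourings either has a SEO or violates both
-- (FV1) and (FV2).
module Submission where

open import Defs
open import Data.Empty using (⊥; ⊥-elim)
open import Data.Fin.Base using (Fin; zero; suc; toℕ; _<_)
open import Data.Fin.Patterns using (0F; 1F; 2F; 3F)
open import Data.Fin.Permutation using (Permutation′; _⟨$⟩ʳ_; insert)
import Data.Fin.Permutation as Permutation
open import Data.Fin.Properties as Fin
  using (_≟_; _<?_; all?; any?; injective⇒≤; <-cmp; <-trans)
open import Data.List.Base as List using (List; []; _∷_; length; filter; map; allFin)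
open import Data.List.Properties using (filter-≐)
open import Data.List.Membership.Propositional.Properties using (∈-lookup)
open import Data.List.Relation.Unary.All as All using ([]; _∷_)
open import Data.List.Relation.Unary.AllPairs using ([]; _∷_)
open import Data.List.Relation.Unary.Unique.DecPropositional using (unique?)
open import Data.List.Relation.Unary.Unique.Propositional using (Unique)
import Data.List.Relation.Unary.Unique.Propositional.Properties as Unique
open import Data.Maybe.Base using (Maybe; nothing; just)
open import Data.Maybe.Properties using () renaming (≡-dec to Maybe-≡-dec)
open import Data.Nat.Base as ℕ using (ℕ; zero; suc; z≤n; s≤s)
import Data.Nat.Properties as ℕ
open import Data.Product.Base using (∃; ∃-syntax; _×_; _,_; proj₁; proj₂)
open import Data.Sign.Base using (Sign; opposite)
import Data.Sign.Properties as Sign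
open import Data.Sum.Base using (_⊎_; inj₁; inj₂; [_,_])
open import Data.Vec.Base as Vec using (Vec; []; _∷_)
import Data.Vec.Functional as F
open import Function.Base using (_∘_; _$_; case_of_)
open import Function.Bundles using (_⇔_; mk⇔; Equivalence; Inverse; Bijection; Injection)
open import Function.Construct.Composition using (_↔-∘_)
open import Function.Definitions using (Injective)
open import Function.Properties.Inverse using (↔⇒⤖; ↔⇒↣; ↔-sym)
open import Level using (0ℓ)
open import Relation.Binary.Core using (Rel)
import Relation.Binary.Definitions as B
open import Relation.Binary.PropositionalEquality
open import Relation.Nullary
open import Relation.Nullary.Decidable using (map′; False; toWitnessFalse; from-yes; _×-dec_; _⊎-dec_; _→-dec_; ¬?)
open import Relation.Unary using (Pred; Decidable)

open Equivalence using (to; from)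

-- Injections into finite sets

∷-injective : ∀ {A : Set} {m} {x : A} {xs : Fin m → A} →
  (∀ i → x ≢ xs i) → Injective _≡_ _≡_ xs → Injective _≡_ _≡_ (x F.∷ xs)
∷-injective x∉ inj {zero}  {zero}  _ = refl
∷-injective x∉ inj {zero}  {suc j} e = contradiction e (x∉ j)
∷-injective x∉ inj {suc i} {zero}  e = contradiction (sym e) (x∉ i)
∷-injective x∉ inj {suc i} {suc j} e = cong suc (inj e)

lookup-injective : ∀ {A : Set} {xs : List A} → Unique xs → Injective _≡_ _≡_ (List.lookup xs)
lookup-injective (x∉ ∷ u) {zero}  {zero}  _ = refl
lookup-injective (x∉ ∷ u) {zero}  {suc j} e = contradiction e (All.lookup x∉ (∈-lookup j))
lookup-injective (x∉ ∷ u) {suc i} {zero}  e = contradiction (sym e) (All.lookup x∉ (∈-lookup i))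
lookup-injective (x∉ ∷ u) {suc i} {suc j} e = cong suc (lookup-injective u e)

-- A value missed by `c` could be put in front of it, which would inject `Fin (suc n)` into `Fin n`.
injective⇒surjective : ∀ {n} {c : Fin n → Fin n} → Injective _≡_ _≡_ c → ∀ y → ∃[ i ] y ≡ c i
injective⇒surjective {c = c} inj y with any? (λ i → y ≟ c i)
... | yes y∈ = y∈
... | no  y∉ = contradiction
  (injective⇒≤ (∷-injective (λ i e → y∉ (i , e)) inj)) ℕ.1+n≰n

-- Applied to an ordering restricted to chosen distinct vertices, this finds the one ordered last,
-- the only place where (E1) and (E2) are used. The induction compares the head with the maximum of
-- the tail.
maximum : ∀ {m n} {c : Fin (suc m) → Fin n} → Injective _≡_ _≡_ c →
  ∃[ i ] (∀ j → j ≢ i → c j < c i)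
maximum {zero} inj = zero , λ { zero 0≢0 → contradiction refl 0≢0 }
maximum {suc m} {c = c} inj with maximum (Fin.suc-injective ∘ inj)
... | i , max with <-cmp (c zero) (c (suc i))
...   | B.tri< c₀<cᵢ _ _ = suc i , λ
        { zero    _   → c₀<cᵢ
        ; (suc j) j≢i → max j (j≢i ∘ cong suc) }
...   | B.tri≈ _ c₀≡cᵢ _ with () ← inj c₀≡cᵢ
...   | B.tri> _ _ cᵢ<c₀ = zero , λ
        { zero    0≢0 → contradiction refl 0≢0
        ; (suc j) _   → below j }
  where
  below : ∀ j → c (suc j) < c zero
  below j with j ≟ i
  ... | yes refl = cᵢ<c₀
  ... | no  j≢i  = <-trans (max j j≢i) cᵢ<c₀

-- Degrees and enumerations of the vertex set

length-filter-map : ∀ {A B : Set} {P : Pred B 0ℓ} (P? : Decidable P) (f : A → B) xs →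
  length (filter P? (map f xs)) ≡ length (filter (P? ∘ f) xs)
length-filter-map P? f [] = refl
length-filter-map P? f (x ∷ xs) with P? (f x)
... | yes _ = cong suc (length-filter-map P? f xs)
... | no  _ = length-filter-map P? f xs

module _ {n} (G : Graph n) where
  open Graph G
  open Inverse enumerate using (strictlyInverseʳ) renaming (to to index; from to vertex)

  -- `degree` counts along the enumerated list of vertices, so the count can be moved to indices,
  -- where it can be computed.
  degree-≐ : ∀ {Q : Pred (Fin n) 0ℓ} (Q? : Decidable Q) v →
    (∀ j → Adj v (vertex j) ⇔ Q j) → degree v ≡ length (filter Q? (allFin n))
  degree-≐ Q? v eq = trans (length-filter-map (adj? v) vertex (allFin n))
    (cong length (filter-≐ (adj? v ∘ vertex) Q?
      ((λ {j} → to (eq j)) , λ {j} → from (eq j)) (allFin n)))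

  index-injective : Injective _≡_ _≡_ index
  index-injective = Injection.injective (↔⇒↣ enumerate)

  vertex-injective : Injective _≡_ _≡_ vertex
  vertex-injective = Injection.injective (↔⇒↣ (↔-sym enumerate))

  -- Lets the necessity proof split constructively on whether (FV1) holds.
  hasVertexOfDegree? : ∀ d → Dec (HasVertexOfDegree G d)
  hasVertexOfDegree? d = map′
    (λ (i , e) → vertex i , e)
    (λ (v , e) → index v , trans (cong degree (strictlyInverseʳ v)) e)
    (any? λ i → degree (vertex i) ℕ.≟ d)

  V-injective⇒≤ : ∀ {m} {c : Fin m → V} → Injective _≡_ _≡_ c → m ℕ.≤ n
  V-injective⇒≤ inj = injective⇒≤ (inj ∘ index-injective)

  V-injective⇒surjective : {c : Fin n → V} → Injective _≡_ _≡_ c → ∀ y → ∃[ i ] y ≡ c i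
  V-injective⇒surjective inj y
    with i , e ← injective⇒surjective (inj ∘ index-injective) (index y)
    = i , index-injective e

-- By irreflexivity the neighbours of `v` are exactly the vertices with another index, and deleting
-- any one index from `Fin 4` leaves three.
dominating⇒degree≡3 : (G : Graph 4) → let open Graph G in
  ∀ v → (∀ y → v ≢ y → Adj v y) → degree v ≡ 3
dominating⇒degree≡3 G v dom = trans
  (degree-≐ G (λ j → ¬? (index v ≟ j)) v λ j → mk⇔
    (λ { a refl → adj-irrefl (sym (strictlyInverseʳ v)) a })
    (λ i≢j → dom _ λ { refl → i≢j (strictlyInverseˡ j) }))
  (complement (index v))
  where
  open Graph G
  open Inverse enumerate using (strictlyInverseʳ; strictlyInverseˡ) renaming (to to index)
  complement : ∀ i → length (filter (λ j → ¬? (i ≟ j)) (allFin 4)) ≡ 3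
  complement 0F = refl
  complement 1F = refl
  complement 2F = refl
  complement 3F = refl

-- Necessity: consequences of a signed elimination ordering

module SEO (G : SignedGraph 4) (ordering : Ordering G) (seo : IsSEO G ordering) where
  open SignedGraph G
  open Bijection ordering using () renaming (to to ν; injective to ν-injective)

  Top : ∀ {m} → (Fin m → V) → Fin m → Set
  Top c i = ∀ j → j ≢ i → ν (c j) < ν (c i)

  module _ {m} {c : Fin m → V} (inj : Injective _≡_ _≡_ c) {i} (top : Top c i) where
    -- Distinctness is asked for as `False` of a decision, so that for literal indices it is filled
    -- in by evaluation.
    conditions : ∀ j k {j≢i : False (j ≟ i)} {k≢i : False (k ≟ i)} {j≢k : False (j ≟ k)} σ →
      (E σ (c j) (c i) → E σ (c i) (c k) → E σ (c j) (c k))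
        × (E σ (c j) (c k) → E (opposite σ) (c k) (c i) → E σ (c j) (c i))
    conditions j k {j≢i} {k≢i} {j≢k} = seo (c j) (c k) (c i)
      ((toWitnessFalse j≢k ∘ inj ∷ toWitnessFalse j≢i ∘ inj ∷ [])
        ∷ (toWitnessFalse k≢i ∘ inj ∷ []) ∷ [] ∷ [])
      (top j (toWitnessFalse j≢i)) (top k (toWitnessFalse k≢i))

    E1 : ∀ j k {j≢i : False (j ≟ i)} {k≢i : False (k ≟ i)} {j≢k : False (j ≟ k)} {σ} →
      E σ (c j) (c i) → E σ (c i) (c k) → E σ (c j) (c k)
    E1 j k {p} {q} {r} {σ} = proj₁ (conditions j k {p} {q} {r} σ)

    E2 : ∀ j k {j≢i : False (j ≟ i)} {k≢i : False (k ≟ i)} {j≢k : False (j ≟ k)} {σ} →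
      E σ (c j) (c k) → E (opposite σ) (c k) (c i) → E σ (c j) (c i)
    E2 j k {p} {q} {r} {σ} = proj₂ (conditions j k {p} {q} {r} σ)

    -- This is (E2) for the sign `opposite σ`. The cases on `σ` are there because
    -- `opposite (opposite σ)` reduces to `σ` only for a concrete sign.
    E2⁻ : ∀ j k {j≢i : False (j ≟ i)} {k≢i : False (k ≟ i)} {j≢k : False (j ≟ k)} {σ} →
      E (opposite σ) (c j) (c k) → E σ (c k) (c i) → E (opposite σ) (c j) (c i)
    E2⁻ j k {p} {q} {r} {Sign.+} = proj₂ (conditions j k {p} {q} {r} Sign.-)
    E2⁻ j k {p} {q} {r} {Sign.-} = proj₂ (conditions j k {p} {q} {r} Sign.+)

  -- The vertex of the cycle ordered last has two neighbours on the cycle, and (E1) joins them by a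
  -- chord, which an induced cycle of length four does not have.
  chordal : ∀ σ → Chordal (part σ)
  chordal σ k 4≤k (c , inj , c-adj)
    -- Distinct vertices of a cycle number at most four, so `k` is 4.
    with refl ← ℕ.≤-antisym (V-injective⇒≤ graph inj) 4≤k
    with maximum (inj ∘ ν-injective)
  -- The neighbours of 0 on the cycle are 1 and, through the closing edge, 3. The four absurd
  -- patterns say that this diagonal is not an edge of the cycle; the other three cases are alike.
  ... | 0F , top with to (c-adj 1F 3F) (E1 inj top 1F 3F
                        (from (c-adj 1F 0F) (inj₁ (inj₂ refl)))
                        (from (c-adj 0F 3F) (inj₂ (inj₁ (refl , refl)))))
  ...   | inj₁ (inj₁ ())
  ...   | inj₁ (inj₂ ())
  ...   | inj₂ (inj₁ (() , _))
  ...   | inj₂ (inj₂ (() , _))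
  chordal σ k 4≤k (c , inj , c-adj)
      | 1F , top with to (c-adj 0F 2F) (E1 inj top 0F 2F
                        (from (c-adj 0F 1F) (inj₁ (inj₁ refl)))
                        (from (c-adj 1F 2F) (inj₁ (inj₁ refl))))
  ...   | inj₁ (inj₁ ())
  ...   | inj₁ (inj₂ ())
  ...   | inj₂ (inj₁ (_ , ()))
  ...   | inj₂ (inj₂ (() , _))
  chordal σ k 4≤k (c , inj , c-adj)
      | 2F , top with to (c-adj 1F 3F) (E1 inj top 1F 3F
                        (from (c-adj 1F 2F) (inj₁ (inj₁ refl)))
                        (from (c-adj 2F 3F) (inj₁ (inj₁ refl))))
  ...   | inj₁ (inj₁ ())
  ...   | inj₁ (inj₂ ())
  ...   | inj₂ (inj₁ (() , _))
  ...   | inj₂ (inj₂ (() , _))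
  chordal σ k 4≤k (c , inj , c-adj)
      | 3F , top with to (c-adj 0F 2F) (E1 inj top 0F 2F
                        (from (c-adj 0F 3F) (inj₂ (inj₁ (refl , refl))))
                        (from (c-adj 3F 2F) (inj₁ (inj₂ refl))))
  ...   | inj₁ (inj₁ ())
  ...   | inj₁ (inj₂ ())
  ...   | inj₂ (inj₁ (_ , ()))
  ...   | inj₂ (inj₂ (() , _))

  -- Each choice of the last vertex forces a missing edge: the apex last gives `w` joined to `v 0F`,
  -- an end of the path last gives `w` joined to that end, and the middle `v 1F` last gives `v 0F`
  -- joined to `v 2F`.
  ¬mountain : ¬ Mountain G
  ¬mountain (σ , m , v , w , mountain)
    -- The apex and the `m` path vertices are distinct, so `suc m` is at most 4; with `3≤m` this
    -- leaves `m` equal to 3.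
    with refl ← ℕ.≤-antisym
      (ℕ.s≤s⁻¹ (V-injective⇒≤ graph
        (∷-injective (IsMountainEnumeration.w≢v mountain) (IsMountainEnumeration.v-injective mountain))))
      (IsMountainEnumeration.3≤m mountain)
    = impossible (maximum (c-injective ∘ ν-injective))
    where
    open IsMountainEnumeration mountain
    c : Fin 4 → V
    c = w F.∷ v
    c-injective : Injective _≡_ _≡_ c
    c-injective = ∷-injective w≢v v-injective
    v₀v₁ : E (opposite σ) (v 0F) (v 1F)
    v₀v₁ = path-edge 0F 1F refl
    v₁v₂ : E (opposite σ) (v 1F) (v 2F)
    v₁v₂ = path-edge 1F 2F refl
    wv₁ : E σ w (v 1F)
    wv₁ = apex-edge 1F (s≤s z≤n , s≤s (s≤s (s≤s z≤n)))
    impossible : ¬ ∃ (Top c)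
    impossible (0F , top) with apex-only 0F (E⇒adj _ (E-sym _ (E2⁻ c-injective top 1F 2F v₀v₁ (E-sym _ wv₁))))
    ... | () , _
    impossible (1F , top) with apex-only 0F (E⇒adj _ (E2 c-injective top 0F 2F wv₁ (E-sym _ v₀v₁)))
    ... | () , _
    impossible (2F , top) with path-only 0F 2F (E⇒adj _ (E1 c-injective top 1F 3F v₀v₁ v₁v₂))
    ... | inj₁ ()
    ... | inj₂ ()
    impossible (3F , top) with apex-only 2F (E⇒adj _ (E2 c-injective top 0F 2F wv₁ v₁v₂))
    ... | _ , s≤s (s≤s (s≤s ()))

  three-neighbours : ∀ {c : Fin 4 → V} → Injective _≡_ _≡_ c → ∀ {σ} i →
    (∀ j → i ≢ j → E σ (c i) (c j)) → HasVertexOfDegree (part σ) 3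
  three-neighbours {c} inj {σ} i adj = c i , dominating⇒degree≡3 (part σ) (c i) dom
    where
    dom : ∀ y → c i ≢ y → E σ (c i) y
    dom y cᵢ≢y with j , refl ← V-injective⇒surjective graph inj y = adj j (cᵢ≢y ∘ cong c)

  -- The sign is that of the two outer edges. If the last vertex is `u` or `v`, the far end `x` is
  -- joined to all others with this sign; if it is `w` or `x`, the far end `u` is. The two halves
  -- are mirror images under reversing the path.
  alternating⇒degree≡3 : AlternatingFourPath G → ∃[ σ ] HasVertexOfDegree (part σ) 3
  alternating⇒degree≡3 (u , v , w , x , σ , unique , uv , vw , wx) =
    σ , cases (maximum (c-injective ∘ ν-injective))
    where
    c : Fin 4 → V
    c = List.lookup (u ∷ v ∷ w ∷ x ∷ [])
    c-injective : Injective _≡_ _≡_ c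
    c-injective = lookup-injective unique

    at-u : E σ u v → E σ u w → E σ u x → HasVertexOfDegree (part σ) 3
    at-u uv uw ux = three-neighbours c-injective 0F λ
      { 0F 0≢0 → contradiction refl 0≢0 ; 1F _ → uv ; 2F _ → uw ; 3F _ → ux }
    at-x : E σ x u → E σ x v → E σ x w → HasVertexOfDegree (part σ) 3
    at-x xu xv xw = three-neighbours c-injective 3F λ
      { 0F _ → xu ; 1F _ → xv ; 2F _ → xw ; 3F 3≢3 → contradiction refl 3≢3 }

    cases : ∃ (Top c) → HasVertexOfDegree (part σ) 3
    cases (0F , top) = at-x xu xv (E-sym σ wx)
      where
      -- The edge `wu` gets the sign of the middle edge `vw`. It then serves as the edge of opposite
      -- sign in (E2), which carries `xw` over to `xu`.
      wu = E2⁻ c-injective top 2F 1F (E-sym _ vw) (E-sym σ uv)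
      xu = E2 c-injective top 3F 2F (E-sym σ wx) wu
      xv = E1 c-injective top 3F 1F xu uv
    cases (1F , top) = at-x xu xv (E-sym σ wx)
      where
      xv = E2 c-injective top 3F 2F (E-sym σ wx) (E-sym _ vw)
      xu = E1 c-injective top 3F 0F xv (E-sym σ uv)
    cases (2F , top) = at-u uv uw ux
      where
      uw = E2 c-injective top 0F 1F uv vw
      ux = E1 c-injective top 0F 3F uw wx
    cases (3F , top) = at-u uv uw ux
      where
      vx = E2⁻ c-injective top 1F 2F vw wx
      ux = E2 c-injective top 0F 1F uv vx
      uw = E1 c-injective top 0F 2F ux (E-sym σ wx)

-- Exhaustive search over signs, colours and vectors

allMaybe? : ∀ {A : Set} → (∀ {P : Pred A 0ℓ} → Decidable P → Dec (∀ x → P x)) →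
  {P : Pred (Maybe A) 0ℓ} → Decidable P → Dec (∀ x → P x)
allMaybe? all-A? P? = map′
  (λ { (p , ps) nothing → p ; (p , ps) (just x) → ps x })
  (λ ps → ps nothing , ps ∘ just)
  (P? nothing ×-dec all-A? (P? ∘ just))

allVec? : ∀ {A : Set} → (∀ {P : Pred A 0ℓ} → Decidable P → Dec (∀ x → P x)) →
  ∀ {n} {P : Pred (Vec A n) 0ℓ} → Decidable P → Dec (∀ xs → P xs)
allVec? all-A? {zero}  P? = map′ (λ { p [] → p }) (λ ps → ps []) (P? [])
allVec? all-A? {suc n} P? = map′ (λ { ps (x ∷ xs) → ps x xs }) (λ ps x xs → ps (x ∷ xs))
  (all-A? λ x → allVec? all-A? (P? ∘ (x ∷_)))

allSign? : {P : Pred Sign 0ℓ} → Decidable P → Dec (∀ σ → P σ)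
allSign? P? = map′
  (λ { (p , q) Sign.+ → p ; (p , q) Sign.- → q }) (λ ps → ps Sign.+ , ps Sign.-)
  (P? Sign.+ ×-dec P? Sign.-)

anySign? : {P : Pred Sign 0ℓ} → Decidable P → Dec (∃ P)
anySign? P? = map′
  [ Sign.+ ,_ , Sign.- ,_ ]
  (λ { (Sign.+ , p) → inj₁ p ; (Sign.- , p) → inj₂ p })
  (P? Sign.+ ⊎-dec P? Sign.-)

consecutive? : ∀ {k} → B.Decidable (Consecutive {k})
consecutive? i j = (suc (toℕ i) ℕ.≟ toℕ j) ⊎-dec (suc (toℕ j) ℕ.≟ toℕ i)

interior? : ∀ {m} → Decidable (Interior {m})
interior? {m} i = (0 ℕ.<? toℕ i) ×-dec (suc (toℕ i) ℕ.<? m)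

cyclicallyConsecutive? : ∀ {k} → B.Decidable (CyclicallyConsecutive {k})
cyclicallyConsecutive? {k} i j = consecutive? i j
  ⊎-dec (((toℕ i ℕ.≟ 0) ×-dec (suc (toℕ j) ℕ.≟ k))
  ⊎-dec ((toℕ j ℕ.≟ 0) ×-dec (suc (toℕ i) ℕ.≟ k)))

-- Every permutation of Fin 4 is of this form (up to pointwise equality), so that
-- a search over orderings is a search over a, b and c.
insertions : Fin 4 → Fin 3 → Fin 2 → Permutation′ 4
insertions a b c = insert 0F a (insert 0F b (insert 0F c Permutation.id))

-- Decidable properties of colourings of the pairs in `Fin 4`

module Coloured (colour : Fin 4 → Fin 4 → Maybe Sign) where

  R : Sign → Rel (Fin 4) 0ℓ
  R σ i j = colour i j ≡ just σ

  R? : ∀ σ → B.Decidable (R σ)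
  R? σ i j = Maybe-≡-dec Sign._≟_ (colour i j) (just σ)

  -- The strict inequalities separate `w` from `u` and `v`, so `u ≢ v` completes the distinctness of
  -- the triple.
  Elimination : (Fin 4 → Fin 4) → Set
  Elimination ν = ∀ u v w → u ≢ v → ν u < ν w → ν v < ν w → ∀ σ →
    (R σ u w → R σ w v → R σ u v) × (R σ u v → R (opposite σ) v w → R σ u w)

  elimination? : Decidable Elimination
  elimination? ν = all? λ u → all? λ v → all? λ w →
    ¬? (u ≟ v) →-dec ((ν u <? ν w) →-dec ((ν v <? ν w) →-dec allSign? λ σ →
      (R? σ u w →-dec (R? σ w v →-dec R? σ u v))
        ×-dec (R? σ u v →-dec (R? (opposite σ) v w →-dec R? σ u w))))

  Eliminable : Set
  Eliminable = ∃[ a ] ∃[ b ] ∃[ c ] Elimination (insertions a b c ⟨$⟩ʳ_)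

  eliminable? : Dec Eliminable
  eliminable? = any? λ a → any? λ b → any? λ c → elimination? _

  Cycle : Sign → (Fin 4 → Fin 4) → Set
  Cycle σ c = ∀ i j →
    (R σ (c i) (c j) → CyclicallyConsecutive i j)
      × (CyclicallyConsecutive i j → R σ (c i) (c j))

  cycle? : ∀ σ → Decidable (Cycle σ)
  cycle? σ c = all? λ i → all? λ j →
    (R? σ (c i) (c j) →-dec cyclicallyConsecutive? i j)
      ×-dec (cyclicallyConsecutive? i j →-dec R? σ (c i) (c j))

  -- With four vertices the path of a mountain has exactly three. Adjacency is expressed as being
  -- joined with some sign `τ`. Injectivity and exhaustiveness will come from the distinctness
  -- required in `HasForbidden`.
  MountainEdges : Sign → (Fin 3 → Fin 4) → Fin 4 → Set
  MountainEdges σ v w =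
    (∀ i j → suc (toℕ i) ≡ toℕ j → R (opposite σ) (v i) (v j))
      × (∀ i → Interior i → R σ w (v i))
      × (∀ τ i j → R τ (v i) (v j) → Consecutive i j)
      × (∀ τ i → R τ w (v i) → Interior i)

  mountainEdges? : ∀ σ v → Decidable (MountainEdges σ v)
  mountainEdges? σ v w =
    (all? λ i → all? λ j → (suc (toℕ i) ℕ.≟ toℕ j) →-dec R? (opposite σ) (v i) (v j))
      ×-dec ((all? λ i → interior? i →-dec R? σ w (v i))
      ×-dec ((allSign? λ τ → all? λ i → all? λ j → R? τ (v i) (v j) →-dec consecutive? i j)
      ×-dec (allSign? λ τ → all? λ i → R? τ w (v i) →-dec interior? i)))

  Alternating : Sign → (Fin 4 → Fin 4) → Set
  Alternating σ c = R σ (c 0F) (c 1F) × R (opposite σ) (c 1F) (c 2F) × R σ (c 2F) (c 3F)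

  alternating? : ∀ σ → Decidable (Alternating σ)
  alternating? σ c =
    R? σ (c 0F) (c 1F) ×-dec (R? (opposite σ) (c 1F) (c 2F) ×-dec R? σ (c 2F) (c 3F))

  Forbidden : Sign → (Fin 4 → Fin 4) → Set
  Forbidden σ c = Cycle σ c ⊎ MountainEdges σ (c ∘ suc) (c 0F) ⊎ Alternating σ c

  -- One list of four distinct indices serves all three obstructions: read cyclically as a 4-cycle,
  -- as an apex followed by the path of a mountain, or in order as an alternating path.
  HasForbidden : Set
  HasForbidden = ∃[ p ] ∃[ q ] ∃[ r ] ∃[ s ]
    let vs = p ∷ q ∷ r ∷ s ∷ [] in Unique vs × ∃[ σ ] Forbidden σ (List.lookup vs)

  hasForbidden? : Dec HasForbidden
  hasForbidden? = any? λ p → any? λ q → any? λ r → any? λ s →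
    let c = List.lookup (p ∷ q ∷ r ∷ s ∷ []) in
    unique? _≟_ (p ∷ q ∷ r ∷ s ∷ []) ×-dec anySign? λ σ →
      cycle? σ c ⊎-dec (mountainEdges? σ (c ∘ suc) (c 0F) ⊎-dec alternating? σ c)

  NoDegree3 : Set
  NoDegree3 = ∀ σ i → length (filter (R? σ i) (allFin 4)) ≢ 3

  noDegree3? : Dec NoDegree3
  noDegree3? = allSign? λ σ → all? λ i → ¬? (length (filter (R? σ i) (allFin 4)) ℕ.≟ 3)

-- A symmetric table with uncoloured diagonal; the six entries are the colours of the pairs 01, 02,
-- 03, 12, 13, 23.
colouring : Vec (Maybe Sign) 6 → Fin 4 → Fin 4 → Maybe Sign
colouring (a ∷ b ∷ c ∷ d ∷ e ∷ f ∷ []) i j = Vec.lookup (Vec.lookup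
  ( (nothing ∷ a ∷ b ∷ c ∷ [])
  ∷ (a ∷ nothing ∷ d ∷ e ∷ [])
  ∷ (b ∷ d ∷ nothing ∷ f ∷ [])
  ∷ (c ∷ e ∷ f ∷ nothing ∷ [])
  ∷ []) i) j

abstract
  -- Both alternatives are decidable, so the claim is established by evaluating the decision on
  -- every vector of six colours. `abstract` keeps this evaluation from being unfolded where the
  -- result is applied.
  eliminable⊎obstructed : ∀ cs → let open Coloured (colouring cs) in
    Eliminable ⊎ (NoDegree3 × HasForbidden)
  eliminable⊎obstructed = from-yes $ allVec? (allMaybe? allSign?) λ cs →
    let open Coloured (colouring cs) in eliminable? ⊎-dec (noDegree3? ×-dec hasForbidden?)

-- Transfer between a signed graph and its colouring

module Encoding (G : SignedGraph 4) where
  open SignedGraph G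
  open Inverse enumerate using (strictlyInverseˡ; strictlyInverseʳ)
    renaming (to to index; from to vertex)

  Encodes : V → V → Maybe Sign → Set
  Encodes u v c = ∀ σ → E σ u v ⇔ c ≡ just σ

  E-unique : ∀ {σ τ u v} → E σ u v → E τ u v → σ ≡ τ
  E-unique {Sign.+} {Sign.+} e e′ = refl
  E-unique {Sign.+} {Sign.-} e e′ = contradiction e′ (disjoint e)
  E-unique {Sign.-} {Sign.+} e e′ = contradiction e (disjoint e′)
  E-unique {Sign.-} {Sign.-} e e′ = refl

  encode : ∀ u v → ∃ (Encodes u v)
  encode u v with adj? u v
  ... | no ¬a = nothing , λ σ → mk⇔ (λ e → contradiction (E⇒adj σ e) ¬a) λ ()
  ... | yes a with τ , e ← adj⇒E a =
    just τ , λ σ → mk⇔ (cong just ∘ E-unique e) λ { refl → e }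

  encodes-refl : ∀ {v} → Encodes v v nothing
  encodes-refl σ = mk⇔ (λ e → contradiction (E⇒adj σ e) (adj-irrefl refl)) λ ()

  encodes-sym : ∀ {u v c} → Encodes u v c → Encodes v u c
  encodes-sym enc σ = mk⇔ (to (enc σ) ∘ E-sym σ) (E-sym σ ∘ from (enc σ))

  colour : Fin 4 → Fin 4 → Maybe Sign
  colour i j = proj₁ (encode (vertex i) (vertex j))

  colours : Vec (Maybe Sign) 6
  colours = colour 0F 1F ∷ colour 0F 2F ∷ colour 0F 3F
    ∷ colour 1F 2F ∷ colour 1F 3F ∷ colour 2F 3F ∷ []

  open Coloured (colouring colours)

  -- Only the pairs above the diagonal were read off from the graph; below it the table is right by
  -- symmetry of the edges, and on it by irreflexivity.
  E⇔R : ∀ i j {σ} → E σ (vertex i) (vertex j) ⇔ R σ i j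
  E⇔R i j {σ} = encodes i j σ
    where
    encodes : ∀ i j → Encodes (vertex i) (vertex j) (colouring colours i j)
    encodes 0F 0F = encodes-refl
    encodes 0F 1F = proj₂ (encode _ _)
    encodes 0F 2F = proj₂ (encode _ _)
    encodes 0F 3F = proj₂ (encode _ _)
    encodes 1F 0F = encodes-sym (proj₂ (encode _ _))
    encodes 1F 1F = encodes-refl
    encodes 1F 2F = proj₂ (encode _ _)
    encodes 1F 3F = proj₂ (encode _ _)
    encodes 2F 0F = encodes-sym (proj₂ (encode _ _))
    encodes 2F 1F = encodes-sym (proj₂ (encode _ _))
    encodes 2F 2F = encodes-refl
    encodes 2F 3F = proj₂ (encode _ _)
    encodes 3F 0F = encodes-sym (proj₂ (encode _ _))
    encodes 3F 1F = encodes-sym (proj₂ (encode _ _))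
    encodes 3F 2F = encodes-sym (proj₂ (encode _ _))
    encodes 3F 3F = encodes-refl

  E⇔R-index : ∀ u v {σ} → E σ u v ⇔ R σ (index u) (index v)
  E⇔R-index u v {σ} = subst₂ (λ u′ v′ → E σ u′ v′ ⇔ R σ (index u) (index v))
    (strictlyInverseʳ u) (strictlyInverseʳ v) (E⇔R (index u) (index v))

  eliminable : Eliminable → SignedEliminable G
  eliminable (a , b , c , elimination) = ordering , seo
    where
    ordering : Ordering G
    -- The position of a vertex is the permuted value of its index, so the inequalities in `seo` are
    -- literally those expected by `elimination`.
    ordering = ↔⇒⤖ (insertions a b c ↔-∘ enumerate)
    seo : IsSEO G ordering
    seo u v w ((u≢v ∷ _) ∷ _) νu<νw νv<νw σ
      with e₁ , e₂ ← elimination (index u) (index v) (index w)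
        (u≢v ∘ index-injective graph) νu<νw νv<νw σ
      = (λ uw wv → from (E⇔R-index u v) (e₁ (to (E⇔R-index u w) uw) (to (E⇔R-index w v) wv)))
      , (λ uv vw → from (E⇔R-index u w) (e₂ (to (E⇔R-index u v) uv) (to (E⇔R-index v w) vw)))

  no-degree3 : NoDegree3 → ∀ σ → ¬ HasVertexOfDegree (part σ) 3
  no-degree3 no3 σ (v , deg≡3) = no3 σ (index v) (trans (sym (degree-≐ (part σ) (R? σ (index v)) v
    λ j → subst (λ v′ → E σ v′ (vertex j) ⇔ R σ (index v) j) (strictlyInverseʳ v) (E⇔R (index v) j)))
    deg≡3)

  forbidden : HasForbidden → (∀ σ → Chordal (part σ)) → ¬ Mountain G → ¬ AlternatingFourPath G → ⊥
  forbidden (p , q , r , s , unique , σ , obstruction) chordal ¬mountain ¬alternating = refute obstruction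
    where
    c : Fin 4 → Fin 4
    c = List.lookup (p ∷ q ∷ r ∷ s ∷ [])
    c-injective : Injective _≡_ _≡_ c
    c-injective = lookup-injective unique
    refute : Forbidden σ c → ⊥
    refute (inj₁ cycle) = chordal σ 4 ℕ.≤-refl (vertex ∘ c , c-injective ∘ vertex-injective graph
      , λ i j → mk⇔ (proj₁ (cycle i j) ∘ to (E⇔R _ _)) (from (E⇔R _ _) ∘ proj₂ (cycle i j)))
    refute (inj₂ (inj₁ (path-edge , apex-edge , path-only , apex-only))) =
      ¬mountain (σ , 3 , vertex ∘ c ∘ suc , vertex (c 0F) , record
        { 3≤m         = ℕ.≤-refl
        ; v-injective = Fin.suc-injective ∘ c-injective ∘ vertex-injective graph
        ; w≢v         = λ i e → contradiction (c-injective {0F} {suc i} (vertex-injective graph e)) λ ()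
        ; exhaustive  = exhaustive
        ; path-edge   = λ i j → from (E⇔R _ _) ∘ path-edge i j
        ; apex-edge   = λ i → from (E⇔R _ _) ∘ apex-edge i
        -- An edge of the graph has some sign `τ`, and the colouring excludes unwanted pairs for
        -- every sign.
        ; path-only   = λ i j a → let τ , e = adj⇒E a in path-only τ i j (to (E⇔R _ _) e)
        ; apex-only   = λ i a → let τ , e = adj⇒E a in apex-only τ i (to (E⇔R _ _) e)
        })
      where
      exhaustive : ∀ x → x ≡ vertex (c 0F) ⊎ ∃[ i ] x ≡ vertex (c (suc i))
      -- Four distinct vertices are all the vertices: index 0 is the apex, and the others lie on the
      -- path.
      exhaustive x with V-injective⇒surjective graph (c-injective ∘ vertex-injective graph) x
      ... | zero  , e = inj₁ e
      ... | suc i , e = inj₂ (i , e)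
    refute (inj₂ (inj₂ (e , f , g))) = ¬alternating
      ( vertex p , vertex q , vertex r , vertex s , σ
      , Unique.map⁺ (vertex-injective graph) unique
      , from (E⇔R _ _) e , from (E⇔R _ _) f , from (E⇔R _ _) g)

proposition6p1 : (G : SignedGraph 4) → let open SignedGraph G in
    SignedEliminable G ⇔
    ((HasVertexOfDegree (part Sign.+) 3 ⊎ HasVertexOfDegree (part Sign.-) 3)
    ⊎ (Chordal (part Sign.+) × Chordal (part Sign.-)
    × ¬ Mountain G × ¬ AlternatingFourPath G))
proposition6p1 G = mk⇔ necessary sufficient
  where
  open SignedGraph G
  open Encoding G
  open Coloured (colouring colours)

  FV1 FV2 : Set
  FV1 = HasVertexOfDegree (part Sign.+) 3 ⊎ HasVertexOfDegree (part Sign.-) 3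
  FV2 = Chordal (part Sign.+) × Chordal (part Sign.-) × ¬ Mountain G × ¬ AlternatingFourPath G

  necessary : SignedEliminable G → FV1 ⊎ FV2
  -- If (FV1) fails for both signs, then an alternating path is impossible as well, since it would
  -- produce a vertex of degree three.
  necessary (ordering , seo) with hasVertexOfDegree? (part Sign.+) 3 | hasVertexOfDegree? (part Sign.-) 3
  ... | yes d | _     = inj₁ (inj₁ d)
  ... | no _  | yes d = inj₁ (inj₂ d)
  ... | no ¬d₊ | no ¬d₋ = inj₂ (chordal Sign.+ , chordal Sign.- , ¬mountain , λ alt →
    case alternating⇒degree≡3 alt of λ
      { (Sign.+ , d) → ¬d₊ d ; (Sign.- , d) → ¬d₋ d })
    where open SEO G ordering seo

  sufficient : FV1 ⊎ FV2 → SignedEliminable G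
  sufficient fv with eliminable⊎obstructed colours
  ... | inj₁ el = eliminable el
  -- The obstructed alternative contradicts either condition: `no3` refutes (FV1), and `bad` refutes
  -- (FV2).
  ... | inj₂ (no3 , bad) with fv
  ...   | inj₁ (inj₁ d) = contradiction d (no-degree3 no3 Sign.+)
  ...   | inj₁ (inj₂ d) = contradiction d (no-degree3 no3 Sign.-)
  ...   | inj₂ (ch₊ , ch₋ , ¬m , ¬a) =
    ⊥-elim (forbidden bad (λ { Sign.+ → ch₊ ; Sign.- → ch₋ }) ¬m ¬a)
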